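{- Let $\mathcal{V}$ be a finite nonempty set of candidates. For a weak tournament $\mathcal{W}$ over $\mathcal{V}$, let $S(\mathcal{W})\subseteq\mathcal{V}$ be the set of alternatives that lie in the maximal subset of a $K$-way partition obtained by making the minimum number of majority relation reversals to $\mathcal{W}$ (as made precise in the context). Then $S$ is an extension of Slater's rule to weak tournaments; that is, whenever $\mathcal{W}$ is a tournament over $\mathcal{V}$, $S(\mathcal{W})$ equals the set of winners that Slater's rule selects from $\mathcal{W}$.
   Context: Relations are sets of ordered pairs of distinct elements of $\mathcal{V}$. A weak tournament $\mathcal{W}$ over $\mathcal{V}$ is a complete relation: for all distinct $a,b\in\mathcal{V}$, at least one of $(a,b),(b,a)$ is in $\mathcal{W}$. Here $(a,b)\in\mathcal{W}$, $(b,a)\notin\mathcal{W}$ means $a\succ b$ (strict majority), and $(a,b),(b,a)\in\mathcal{W}$ means $a\approx b$ (tie). A tournament is a weak tournament that is also asymmetric: exactly one of $(a,b),(b,a)$ belongs to it for all distinct $a,b$. A relation is identified with the digraph on $\mathcal{V}$ having these pairs as arcs. A majority relation reversal replaces a pair $(a,b)$ of the relation with $(b,a)$ (if $(b,a)$ is already present, this just amounts to deleting $(a,b)$). Thus reversing a set $R\subseteq\mathcal{W}$ produces the relation $(\mathcal{W}\setminus R)\cup\{(b,a):(a,b)\in R\}$, and the number of reversals is $|R|$. Slater's rule: for a tournament $\mathcal{T}$, consider all sets of reversals of minimum cardinality among those whose result is an acyclic tournament (i.e. a linear ordering of $\mathcal{V}$). Slater's rule selects the set of all candidates that are the maximal (top)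 element of at least one linear ordering obtained from such a minimum set of reversals. $K$-way partition: a partition $\{\mathcal{N}_1,\dots,\mathcal{N}_K\}$ of the node set of a digraph is an acyclic $K$-way partition if, for all $u\neq v$, it is not the case that there exist both a directed path from some node of $\mathcal{N}_u$ to some node of $\mathcal{N}_v$ and a directed path from some node of $\mathcal{N}_v$ to some node of $\mathcal{N}_u$. The partitions considered here are acyclic $K$-way partitions (for some $K\ge 1$) in which, in addition, each $\mathcal{N}_t$ induces a complete digraph (both arcs present between every two distinct nodes of $\mathcal{N}_t$). For a complete relation, such a partition, if it exists, is the ordered partition into tie classes of a weak ordering, and its maximal subset is the class all of whose members have arcs to all members of every other class. The solution $S$: consider all sets of reversals $R\subseteq\mathcal{W}$ of minimum cardinality among those whose resulting relation admits such a partition; $S(\mathcal{W})$ is the set of all candidates belonging to the maximal subset of the partition obtained from at least one such minimum $R$. A weak tournament solution $S$ (a map assigning to each weak tournament a set of winners) is an extension of a tournament solution $S'$ if $S(\mathcal{W})=S'(\mathcal{W})$ whenever $\mathcal{W}$ is a tournament. -}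

module Defs where

open import Data.Fin using (Fin; combine; remQuot)
open import Data.Fin.Properties using (remQuot-combine)
open import Data.Fin.Subset using (Subset; _∈_; _⊆_; _∪_; _─_; ∣_∣)
open import Data.Nat using (ℕ; _*_; _≤_)
open import Data.Product using (Σ-syntax; ∃-syntax; _×_; _,_; swap; uncurry)
open import Data.Sum using (_⊎_)
open import Data.Vec using (lookup; tabulate)
open import Data.Vec.Properties using (lookup∘tabulate; lookup⇒[]=; []=⇒lookup)
open import Function using (_∘_; _⇔_; mk⇔)
open import Function.Definitions using (Surjective)
open import Level using (0ℓ)
open import Relation.Binary.Construct.Closure.ReflexiveTransitive using (Star)
open import Relation.Binary.Construct.Closure.Transitive using (TransClosure)
open import Relation.Binary.Core using (Rel)
open import Relation.Binary.Definitions using (Asymmetric; Irreflexive)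
open import Relation.Binary.PropositionalEquality
  using (_≡_; _≢_; cong; sym; trans; module ≡-Reasoning)
open import Relation.Nullary using (¬_)
open import Relation.Unary using (Pred; _≐_)

module Voting (n : ℕ) where

  Candidate : Set
  Candidate = Fin n

  -- A set of ordered pairs of candidates; the pair (a , b) is encoded as
  -- combine a b, so that ∣_∣, _⊆_, _∪_ and _─_ on Subset have their usual
  -- meaning for sets of pairs.
  PairSet : Set
  PairSet = Subset (n * n)

  Arc : PairSet → Rel Candidate 0ℓ
  Arc D a b = combine a b ∈ D

  converse : PairSet → PairSet
  converse R = tabulate (lookup R ∘ uncurry combine ∘ swap ∘ remQuot {n} n)

  arc-converse : ∀ R a b → Arc (converse R) a b ⇔ Arc R b a
  arc-converse R a b = mk⇔
    (λ p → lookup⇒[]= _ R (trans (sym eq) ([]=⇒lookup p)))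
    (λ p → lookup⇒[]= _ (converse R) (trans eq ([]=⇒lookup p)))
    where
    open ≡-Reasoning
    eq : lookup (converse R) (combine a b) ≡ lookup R (combine b a)
    eq = begin
      lookup (converse R) (combine a b)
        ≡⟨ lookup∘tabulate _ (combine a b) ⟩
      lookup R (uncurry combine (swap (remQuot {n} n (combine a b))))
        ≡⟨ cong (lookup R ∘ uncurry combine ∘ swap) (remQuot-combine a b) ⟩
      lookup R (combine b a) ∎

  record IsWeakTournament (W : PairSet) : Set where
    field
      irreflexive : Irreflexive _≡_ (Arc W)
      complete    : ∀ {a b} → a ≢ b → Arc W a b ⊎ Arc W b a

  record IsTournament (T : PairSet) : Set where
    field
      isWeakTournament : IsWeakTournament T
      asymmetric       : Asymmetric (Arc T)

    open IsWeakTournament isWeakTournament public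

  record WeakTournament : Set where
    field
      arcs             : PairSet
      isWeakTournament : IsWeakTournament arcs

  record Tournament : Set where
    field
      arcs         : PairSet
      isTournament : IsTournament arcs

    open IsTournament isTournament public

    weakTournament : WeakTournament
    weakTournament = record
      { arcs = arcs ; isWeakTournament = isWeakTournament }

  WeakTournamentSolution : Set₁
  WeakTournamentSolution = WeakTournament → Pred Candidate 0ℓ

  TournamentSolution : Set₁
  TournamentSolution = Tournament → Pred Candidate 0ℓ

  _IsExtensionOf_ : WeakTournamentSolution → TournamentSolution → Set
  S IsExtensionOf S′ = ∀ T → S (Tournament.weakTournament T) ≐ S′ T

  reverse : PairSet → PairSet → PairSet
  reverse W R = (W ─ R) ∪ converse R

  record IsMinimumReversal
    (P : PairSet → Set) (W R : PairSet) : Set where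
    field
      reverses : R ⊆ W
      result   : P (reverse W R)
      minimum  : ∀ R′ → R′ ⊆ W → P (reverse W R′) → ∣ R ∣ ≤ ∣ R′ ∣

  Acyclic : PairSet → Set
  Acyclic D = ∀ a → ¬ TransClosure (Arc D) a a

  IsAcyclicTournament : PairSet → Set
  IsAcyclicTournament D = IsTournament D × Acyclic D

  IsTop : PairSet → Candidate → Set
  IsTop D a = ∀ b → b ≢ a → Arc D a b

  slater : TournamentSolution
  slater T a =
    ∃[ R ] IsMinimumReversal IsAcyclicTournament arcs R
         × IsTop (reverse arcs R) a
    where open Tournament T

  -- Class u of the partition is the fibre of class over u; surjectivity says
  -- that all K classes are nonempty.
  record IsAcyclicPartition
    (D : PairSet) (K : ℕ) (class : Candidate → Fin K) : Set where
    PathBetween : Fin K → Fin K → Set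
    PathBetween u v =
      ∃[ a ] ∃[ b ] class a ≡ u × class b ≡ v × Star (Arc D) a b

    field
      surjective : Surjective _≡_ _≡_ class
      acyclic    : ∀ {u v} → u ≢ v → ¬ (PathBetween u v × PathBetween v u)

  record CompleteClassPartition (D : PairSet) : Set where
    field
      K                  : ℕ
      1≤K                : 1 ≤ K
      class              : Candidate → Fin K
      isAcyclicPartition : IsAcyclicPartition D K class
      classesComplete    : ∀ {a b} → class a ≡ class b → a ≢ b →
                           Arc D a b × Arc D b a

    IsMaximalClass : Fin K → Set
    IsMaximalClass t = ∀ {a b} → class a ≡ t → class b ≢ t → Arc D a b

  partitionSolution : WeakTournamentSolution
  partitionSolution W a =
    ∃[ R ] IsMinimumReversal CompleteClassPartition arcs R
         × (Σ[ p ∈ CompleteClassPartition (reverse arcs R) ]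
            let open CompleteClassPartition p in
            ∃[ t ] IsMaximalClass t × class a ≡ t)
    where open WeakTournament W

-- Reversing arcs of a tournament yields a tournament again.  In a tournament
-- no two distinct nodes carry both arcs, so the classes of a complete-class
-- partition are singletons, and acyclicity of a partition into singletons is
-- acyclicity of the digraph.  Hence both rules minimise over the same sets of
-- reversals, and the maximal class is the singleton of the top element.
module Submission where

open import Defs
open import Data.Empty using (⊥)
open import Data.Fin using (combine; _≟_)
open import Data.Fin.Subset using (Subset; _∈_; _∉_; _⊆_; _─_; inside; outside)
open import Data.Fin.Subset.Properties
  using (_∈?_; x∈p∪q⁺; x∈p∪q⁻; x∈p∧x∉q⇒x∈p─q; p─q⊆p)
open import Data.Nat using (ℕ; NonZero; >-nonZero⁻¹)
open import Data.Product using (_×_; _,_; proj₁; proj₂)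
open import Data.Sum as Sum using (_⊎_; inj₁; inj₂)
open import Data.Vec using (_∷_; here; there)
open import Function using (id; _∘_; _⇔_; mk⇔; Equivalence)
open import Function.Definitions using (Injective)
open import Relation.Binary.Construct.Closure.ReflexiveTransitive
  using (Star; ε; _◅_)
open import Relation.Binary.Construct.Closure.Transitive as Plus
  using (TransClosure; [_]; _∷_)
open import Relation.Binary.Core using (Rel)
open import Relation.Binary.PropositionalEquality using (_≡_; _≢_; refl; sym; trans)
open import Relation.Nullary using (yes; no; contradiction)
open import Relation.Nullary.Decidable using (decidable-stable)

x∈p─q⇒x∉q : ∀ {m x} (p q : Subset m) → x ∈ p ─ q → x ∉ q
x∈p─q⇒x∉q (_ ∷ p) (outside ∷ q) (there x∈p─q) (there x∈q) = x∈p─q⇒x∉q p q x∈p─q x∈q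
x∈p─q⇒x∉q (_ ∷ p) (inside  ∷ q) (there x∈p─q) (there x∈q) = x∈p─q⇒x∉q p q x∈p─q x∈q

module _ {a ℓ} {A : Set a} {_∼_ : Rel A ℓ} where

  plus⇒star : ∀ {x y} → TransClosure _∼_ x y → Star _∼_ x y
  plus⇒star [ x∼y ]      = x∼y ◅ ε
  plus⇒star (x∼y ∷ y∼⁺z) = x∼y ◅ plus⇒star y∼⁺z

  star⇒≡⊎plus : ∀ {x y} → Star _∼_ x y → x ≡ y ⊎ TransClosure _∼_ x y
  star⇒≡⊎plus ε = inj₁ refl
  star⇒≡⊎plus (x∼y ◅ y∼*z) with star⇒≡⊎plus y∼*z
  ... | inj₁ refl = inj₂ [ x∼y ]
  ... | inj₂ y∼⁺z = inj₂ (x∼y ∷ y∼⁺z)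

module _ {n : ℕ} where
  open Voting n

  arc-reverse⁻ : ∀ W R {a b} → Arc (reverse W R) a b → Arc (W ─ R) a b ⊎ Arc R b a
  arc-reverse⁻ W R {a} {b} =
    Sum.map₂ (Equivalence.to (arc-converse R a b)) ∘ x∈p∪q⁻ (W ─ R) (converse R)

  arc-reverse⁺ : ∀ W R {a b} → Arc (W ─ R) a b ⊎ Arc R b a → Arc (reverse W R) a b
  arc-reverse⁺ W R {a} {b} =
    x∈p∪q⁺ ∘ Sum.map₂ (Equivalence.from (arc-converse R a b))

  -- Two distinct nodes carry exactly one arc of `W`, which is either kept or flipped. Since
  -- `R ⊆ W`, every added arc replaces an arc of `W`.
  reverse-isTournament : ∀ {W R} → IsTournament W → R ⊆ W → IsTournament (reverse W R)
  reverse-isTournament {W} {R} W-tournament R⊆W = record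
    { isWeakTournament = record
      { irreflexive = λ { refl → Sum.[ irreflexive refl ∘ p─q⊆p W R , irreflexive refl ∘ R⊆W ]
                                 ∘ arc-reverse⁻ W R }
      ; complete    = λ a≢b → Sum.[ arc-or-reversed , Sum.swap ∘ arc-or-reversed ] (complete a≢b)
      }
    ; asymmetric = λ ab ba → asym (arc-reverse⁻ W R ab) (arc-reverse⁻ W R ba)
    }
    where
    open IsTournament W-tournament

    arc-or-reversed : ∀ {a b} → Arc W a b → Arc (reverse W R) a b ⊎ Arc (reverse W R) b a
    arc-or-reversed {a} {b} ab∈W with combine a b ∈? R
    ... | yes ab∈R = inj₂ (arc-reverse⁺ W R (inj₂ ab∈R))
    ... | no  ab∉R = inj₁ (arc-reverse⁺ W R (inj₁ (x∈p∧x∉q⇒x∈p─q ab∈W ab∉R)))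

    asym : ∀ {a b} → Arc (W ─ R) a b ⊎ Arc R b a → Arc (W ─ R) b a ⊎ Arc R a b → ⊥
    -- Two kept or two flipped arcs would both come from `W`, against its asymmetry; one kept and
    -- one flipped would come from a single arc both outside and inside `R`.
    asym (inj₁ ab) (inj₁ ba) = asymmetric (p─q⊆p W R ab) (p─q⊆p W R ba)
    asym (inj₁ ab) (inj₂ ab∈R) = x∈p─q⇒x∉q W R ab ab∈R
    asym (inj₂ ba∈R) (inj₁ ba) = x∈p─q⇒x∉q W R ba ba∈R
    asym (inj₂ ba∈R) (inj₂ ab∈R) = asymmetric (R⊆W ba∈R) (R⊆W ab∈R)

  -- Every competitor for `Q` is also one for `P`, so the minimum carries over. The equivalence is
  -- asked only for `R′ ⊆ W`: only such results are compared, and these are the ones known to be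
  -- tournaments.
  isMinimumReversal-resp : ∀ {P Q : PairSet → Set} {W R} →
    (∀ {R′} → R′ ⊆ W → P (reverse W R′) ⇔ Q (reverse W R′)) →
    IsMinimumReversal P W R → IsMinimumReversal Q W R
  isMinimumReversal-resp P⇔Q min = record
    { reverses = reverses
    ; result   = Equivalence.to (P⇔Q reverses) result
    ; minimum  = λ R′ R′⊆W → minimum R′ R′⊆W ∘ Equivalence.from (P⇔Q R′⊆W)
    }
    where open IsMinimumReversal min

  module _ {D : PairSet} (D-tournament : IsTournament D) where
    open IsTournament D-tournament

    class-injective : (p : CompleteClassPartition D) →
                      Injective _≡_ _≡_ (CompleteClassPartition.class p)
    class-injective p {a} {b} same = decidable-stable (a ≟ b) λ a≢b →
      let ab , ba = classesComplete same a≢b in asymmetric ab ba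
      where open CompleteClassPartition p

    -- The first arc of a cycle joins distinct nodes, hence distinct classes by `class-injective`;
    -- that arc and the rest of the cycle are then opposite paths between two classes.
    completeClassPartition⇒acyclic : CompleteClassPartition D → Acyclic D
    completeClassPartition⇒acyclic p a = λ where
        [ aa ]      → irreflexive refl aa
        (ab ∷ b∼⁺a) → acyclic
          (λ same → irreflexive (class-injective p same) ab)
          ((_ , _ , refl , refl , ab ◅ ε) , (_ , _ , refl , refl , plus⇒star b∼⁺a))
      where
      open CompleteClassPartition p
      open IsAcyclicPartition isAcyclicPartition

  -- Opposite paths between distinct nodes are both nonempty and concatenate to a cycle. `NonZero n`
  -- supplies `1≤K`, as there are `n` classes.
  acyclic⇒singletonPartition : .{{NonZero n}} → ∀ {D} → Acyclic D → CompleteClassPartition D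
  acyclic⇒singletonPartition D-acyclic = record
    { K                  = n
    ; 1≤K                = >-nonZero⁻¹ n
    ; class              = id
    ; isAcyclicPartition = record
      { surjective = λ a → a , id
      ; acyclic    = λ { u≢v ((_ , _ , refl , refl , u∼*v) , (_ , _ , refl , refl , v∼*u)) →
          D-acyclic _ (star⇒plus u≢v u∼*v Plus.++ star⇒plus (u≢v ∘ sym) v∼*u) }
      }
    ; classesComplete    = λ a≡b a≢b → contradiction a≡b a≢b
    }
    where
    star⇒plus : ∀ {_∼_ : Rel Candidate _} {x y} → x ≢ y → Star _∼_ x y → TransClosure _∼_ x y
    star⇒plus x≢y = Sum.[ (λ x≡y → contradiction x≡y x≢y) , id ] ∘ star⇒≡⊎plus

  completeClassPartition⇔acyclicTournament : .{{NonZero n}} → ∀ {D} → IsTournament D →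
    CompleteClassPartition D ⇔ IsAcyclicTournament D
  completeClassPartition⇔acyclicTournament D-tournament = mk⇔
    (λ p → D-tournament , completeClassPartition⇒acyclic D-tournament p)
    (acyclic⇒singletonPartition ∘ proj₂)

theorem1 : (n : ℕ) .{{_ : NonZero n}} → let open Voting n in
    partitionSolution IsExtensionOf slater
theorem1 n T = partition⊆slater , slater⊆partition
  where
  open Voting n
  open Tournament T
  open IsMinimumReversal

  reversed : ∀ {R} → R ⊆ arcs → IsTournament (reverse arcs R)
  reversed = reverse-isTournament isTournament

  same-goal : ∀ {R} → R ⊆ arcs →
    CompleteClassPartition (reverse arcs R) ⇔ IsAcyclicTournament (reverse arcs R)
  same-goal = completeClassPartition⇔acyclicTournament ∘ reversed

  partition⊆slater : ∀ {a} → partitionSolution weakTournament a → slater T a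
  partition⊆slater (R , min , p , t , t-maximal , a∈t) =
    R , isMinimumReversal-resp same-goal min ,
    -- The maximal class holds no node besides `a`, so its arcs to all other classes reach every
    -- `b ≢ a`.
    λ b b≢a → t-maximal a∈t λ b∈t →
      b≢a (class-injective (reversed (reverses min)) p (trans b∈t (sym a∈t)))

  slater⊆partition : ∀ {a} → slater T a → partitionSolution weakTournament a
  slater⊆partition {a} (R , min , a-top) =
    R , isMinimumReversal-resp (λ R⊆W → let open Equivalence (same-goal R⊆W) in mk⇔ from to) min ,
    acyclic⇒singletonPartition (proj₂ (result min)) ,
    -- With `class = id`, the class of `a` is `a` itself, and its maximality is exactly that `a` is
    -- top.
    a , (λ { refl b≢a → a-top _ b≢a }) , refl
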